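{- Let $t$ be an indeterminate. For every integer $n\ge 0$, $$\sum_{k=0}^n t^k \left(Q_k +2(t-1)P_{k+1}\right) =2t^{n+1}P_{n+1},$$ where $P_k$ and $Q_k$ are the $k$th Pell and Pell-Lucas numbers.
   Context: The Pell numbers $P_k$ and Pell-Lucas numbers $Q_k$ ($k\ge 0$) both satisfy $x_{n+2}=2x_{n+1}+x_n$ for $n\ge 0$, with initial values $P_0=0$, $P_1=1$ and $Q_0=Q_1=2$. -}

module Defs where

open import Algebra.Bundles.Raw using (RawRing)
import Algebra.Definitions.RawSemiring as RawSemiringDefs
open import Data.Fin.Base using (toℕ)
open import Data.Integer.Base as ℤ using (ℤ; 0ℤ; 1ℤ; +_)
open import Data.List.Base using (List; []; _∷_; map)
open import Data.Nat.Base using (ℕ; zero; suc)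
open import Function.Base using (_∘_)
open import Level using (0ℓ)
open import Relation.Binary.PropositionalEquality.Core using (_≡_)

P : ℕ → ℤ
P zero          = + 0
P (suc zero)    = + 1
P (suc (suc n)) = + 2 ℤ.* P (suc n) ℤ.+ P n

Q : ℕ → ℤ
Q zero          = + 2
Q (suc zero)    = + 2
Q (suc (suc n)) = + 2 ℤ.* Q (suc n) ℤ.+ Q n

-- A polynomial in ℤ[t] is a list of coefficients, constant term first.
-- Trailing zeros are allowed, so equality is equality of all coefficients
-- rather than propositional equality of lists.
Poly : Set
Poly = List ℤ

coeff : Poly → ℕ → ℤ
coeff []      _       = 0ℤ
coeff (a ∷ p) zero    = a
coeff (a ∷ p) (suc k) = coeff p k

infix 4 _≈ᴾ_
_≈ᴾ_ : Poly → Poly → Set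
p ≈ᴾ q = ∀ k → coeff p k ≡ coeff q k

infixl 6 _+ᴾ_
_+ᴾ_ : Poly → Poly → Poly
[]      +ᴾ q       = q
(a ∷ p) +ᴾ []      = a ∷ p
(a ∷ p) +ᴾ (b ∷ q) = (a ℤ.+ b) ∷ (p +ᴾ q)

-- (a + t p) q = a q + t (p q)
infixl 7 _*ᴾ_
_*ᴾ_ : Poly → Poly → Poly
[]      *ᴾ q = []
(a ∷ p) *ᴾ q = map (a ℤ.*_) q +ᴾ (0ℤ ∷ (p *ᴾ q))

ℤ[t] : RawRing 0ℓ 0ℓ
ℤ[t] = record
  { Carrier = Poly
  ; _≈_     = _≈ᴾ_
  ; _+_     = _+ᴾ_
  ; _*_     = _*ᴾ_
  ; -_      = map (λ a → ℤ.- a)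
  ; 0#      = []
  ; 1#      = 1ℤ ∷ []
  }

open RawRing ℤ[t] public using (_≈_; _+_; _*_; -_; 0#; 1#; rawSemiring)
open RawSemiringDefs rawSemiring public using (_^_; sum)

infixl 6 _-_
_-_ : Poly → Poly → Poly
p - q = p + - q

const : ℤ → Poly
const a = a ∷ []

t : Poly
t = 0ℤ ∷ 1ℤ ∷ []

∑≤ : (n : ℕ) → (ℕ → Poly) → Poly
∑≤ n f = sum {suc n} (f ∘ toℕ)

infixl 10 ∑≤
syntax ∑≤ n (λ k → x) = ∑[ k ≤ n ] x

{-# OPTIONS --safe #-}

-- The sum telescopes.  Put g k = 2 tᵏ Pₖ.  Since Qₖ + 2 Pₖ = 2 Pₖ₊₁, the k-th
-- summand is 2 tᵏ (t Pₖ₊₁ − Pₖ) = g (k + 1) − g k, and g 0 = 0.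
module Submission where

open import Defs
open import Data.Integer.Base as ℤ using (ℤ; +_; 0ℤ; 1ℤ)
open import Data.Integer.Properties using (+-identityˡ; +-identityʳ; *-zeroʳ)
open import Data.Integer.Tactic.RingSolver using (solve-∀)
open import Data.List.Base using ([]; _∷_; map)
open import Data.Nat.Base using (ℕ; zero; suc)
open import Function.Base using (_∘_)
open import Relation.Binary.PropositionalEquality
  using (_≡_; refl; sym; trans; cong; cong₂; module ≡-Reasoning)

open ≡-Reasoning

-- The telescoping rests on two facts. `Q+2P`, an identity between sequences with the same
-- recurrence, turns each summand into a difference of consecutive terms; `telescope` adds these up
-- for arbitrary polynomials. As equality in ℤ[t] is coefficientwise, everything is checked at a
-- fixed index `i`: the `coeff-` lemmas turn products with constants, `t` or linear factors into
-- integer expressions, which the ring solver handles.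

Q+2P : ∀ k → Q k ℤ.+ + 2 ℤ.* P k ≡ + 2 ℤ.* P (suc k)
Q+2P zero          = refl
Q+2P (suc zero)    = refl
-- Both sides satisfy the Pell recurrence, so the two preceding cases combine linearly.
Q+2P (suc (suc k)) = begin
  (+ 2 ℤ.* Q (suc k) ℤ.+ Q k) ℤ.+ + 2 ℤ.* (+ 2 ℤ.* P (suc k) ℤ.+ P k)
    ≡⟨ regroup (Q (suc k)) (Q k) (P (suc k)) (P k) ⟩
  + 2 ℤ.* (Q (suc k) ℤ.+ + 2 ℤ.* P (suc k)) ℤ.+ (Q k ℤ.+ + 2 ℤ.* P k)
    ≡⟨ cong₂ (λ x y → + 2 ℤ.* x ℤ.+ y) (Q+2P (suc k)) (Q+2P k) ⟩
  + 2 ℤ.* (+ 2 ℤ.* P (suc (suc k))) ℤ.+ + 2 ℤ.* P (suc k)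
    ≡⟨ factor (P (suc (suc k))) (P (suc k)) ⟩
  + 2 ℤ.* P (suc (suc (suc k))) ∎
  where
  regroup : ∀ q₁ q₀ p₁ p₀ →
    (+ 2 ℤ.* q₁ ℤ.+ q₀) ℤ.+ + 2 ℤ.* (+ 2 ℤ.* p₁ ℤ.+ p₀) ≡
    + 2 ℤ.* (q₁ ℤ.+ + 2 ℤ.* p₁) ℤ.+ (q₀ ℤ.+ + 2 ℤ.* p₀)
  regroup = solve-∀

  factor : ∀ x y → + 2 ℤ.* (+ 2 ℤ.* x) ℤ.+ + 2 ℤ.* y ≡ + 2 ℤ.* (+ 2 ℤ.* x ℤ.+ y)
  factor = solve-∀

coeff-+ : ∀ p q i → coeff (p + q) i ≡ coeff p i ℤ.+ coeff q i
coeff-+ []      q       i       = sym (+-identityˡ (coeff q i))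
coeff-+ (a ∷ p) []      i       = sym (+-identityʳ (coeff (a ∷ p) i))
coeff-+ (a ∷ p) (b ∷ q) zero    = refl
coeff-+ (a ∷ p) (b ∷ q) (suc i) = coeff-+ p q i

coeff-map-* : ∀ c p i → coeff (map (c ℤ.*_) p) i ≡ c ℤ.* coeff p i
coeff-map-* c []      i       = sym (*-zeroʳ c)
coeff-map-* c (a ∷ p) zero    = refl
coeff-map-* c (a ∷ p) (suc i) = coeff-map-* c p i

coeff-0∷[] : ∀ i → coeff (0ℤ ∷ []) i ≡ 0ℤ
coeff-0∷[] zero    = refl
coeff-0∷[] (suc i) = refl

coeff-const* : ∀ c p i → coeff (const c * p) i ≡ c ℤ.* coeff p i
coeff-const* c p i = begin
  coeff (map (c ℤ.*_) p + (0ℤ ∷ [])) i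
    ≡⟨ coeff-+ (map (c ℤ.*_) p) (0ℤ ∷ []) i ⟩
  coeff (map (c ℤ.*_) p) i ℤ.+ coeff (0ℤ ∷ []) i
    ≡⟨ cong₂ ℤ._+_ (coeff-map-* c p i) (coeff-0∷[] i) ⟩
  c ℤ.* coeff p i ℤ.+ 0ℤ
    ≡⟨ +-identityʳ _ ⟩
  c ℤ.* coeff p i ∎

coeff-*const : ∀ c p i → coeff (p * const c) i ≡ coeff p i ℤ.* c
coeff-*const c []      i       = refl
coeff-*const c (a ∷ p) zero    = +-identityʳ (a ℤ.* c)
coeff-*const c (a ∷ p) (suc i) = coeff-*const c p i

-- Multiplication by `t` is a shift only up to trailing zeros: `t * []` computes to `0ℤ ∷ 0ℤ ∷ []`.
coeff-t* : ∀ p i → coeff (t * p) i ≡ coeff (0ℤ ∷ p) i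
coeff-t* p i = begin
  coeff (map (0ℤ ℤ.*_) p + (0ℤ ∷ const 1ℤ * p)) i
    ≡⟨ coeff-+ (map (0ℤ ℤ.*_) p) _ i ⟩
  coeff (map (0ℤ ℤ.*_) p) i ℤ.+ coeff (0ℤ ∷ const 1ℤ * p) i
    ≡⟨ cong₂ ℤ._+_ (coeff-map-* 0ℤ p i) (shifted i) ⟩
  0ℤ ℤ.+ coeff (0ℤ ∷ p) i
    ≡⟨ +-identityˡ _ ⟩
  coeff (0ℤ ∷ p) i ∎
  where
  1*x≡x : ∀ x → 1ℤ ℤ.* x ≡ x
  1*x≡x = solve-∀

  shifted : ∀ i → coeff (0ℤ ∷ const 1ℤ * p) i ≡ coeff (0ℤ ∷ p) i
  shifted zero    = refl
  shifted (suc i) = trans (coeff-const* 1ℤ p i) (1*x≡x (coeff p i))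

-- Serves the bracket in each summand, which computes to a two-element list; `0ℤ ∷ p` stands for
-- `t * p`.
coeff-*linear : ∀ a b p i →
  coeff (p * (a ∷ b ∷ [])) i ≡ coeff p i ℤ.* a ℤ.+ coeff (0ℤ ∷ p) i ℤ.* b
coeff-*linear a b []      zero    = refl
coeff-*linear a b []      (suc i) = refl
coeff-*linear a b (c ∷ p) zero    = refl
coeff-*linear a b (c ∷ p) (suc i) = begin
  coeff (const (c ℤ.* b) + p * (a ∷ b ∷ [])) i
    ≡⟨ coeff-+ (const (c ℤ.* b)) (p * (a ∷ b ∷ [])) i ⟩
  coeff (const (c ℤ.* b)) i ℤ.+ coeff (p * (a ∷ b ∷ [])) i
    ≡⟨ cong (ℤ._+_ (coeff (const (c ℤ.* b)) i)) (coeff-*linear a b p i) ⟩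
  coeff (const (c ℤ.* b)) i ℤ.+ (coeff p i ℤ.* a ℤ.+ coeff (0ℤ ∷ p) i ℤ.* b)
    -- The term `c ℤ.* b` is present only at index 0, where `c ∷ p` has its head `c`; beyond that,
    -- `c ∷ p` and `0ℤ ∷ p` agree.
    ≡⟨ merge i ⟩
  coeff p i ℤ.* a ℤ.+ coeff (c ∷ p) i ℤ.* b ∎
  where
  swap : ∀ c b x → c ℤ.* b ℤ.+ (x ℤ.+ 0ℤ) ≡ x ℤ.+ c ℤ.* b
  swap = solve-∀

  merge : ∀ i →
    coeff (const (c ℤ.* b)) i ℤ.+ (coeff p i ℤ.* a ℤ.+ coeff (0ℤ ∷ p) i ℤ.* b) ≡
    coeff p i ℤ.* a ℤ.+ coeff (c ∷ p) i ℤ.* b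
  merge zero    = swap c b (coeff p 0 ℤ.* a)
  merge (suc i) = +-identityˡ _

coeff-2*const : ∀ p c i → coeff (const (+ 2) * p * const c) i ≡ + 2 ℤ.* coeff p i ℤ.* c
coeff-2*const p c i =
  trans (coeff-*const c (const (+ 2) * p) i) (cong (ℤ._* c) (coeff-const* (+ 2) p i))

-- Since `sum` splits off its first term, the induction absorbs `f 0` into `g 0`, giving `g 1`, and
-- continues with both sequences shifted by one; hence the generality in `f` and `g`.
telescope : (f g : ℕ → Poly) → (∀ k → f k + g k ≈ g (suc k)) →
  ∀ n → ∑≤ n f + g 0 ≈ g (suc n)
telescope f g step zero i = begin
  coeff (f 0 + [] + g 0) i
    ≡⟨ coeff-+ (f 0 + []) (g 0) i ⟩
  coeff (f 0 + []) i ℤ.+ coeff (g 0) i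
    ≡⟨ cong (ℤ._+ coeff (g 0) i) (trans (coeff-+ (f 0) [] i) (+-identityʳ (coeff (f 0) i))) ⟩
  coeff (f 0) i ℤ.+ coeff (g 0) i
    ≡⟨ coeff-+ (f 0) (g 0) i ⟨
  coeff (f 0 + g 0) i
    ≡⟨ step 0 i ⟩
  coeff (g 1) i ∎
telescope f g step (suc n) i = begin
  coeff (f 0 + S + g 0) i
    ≡⟨ coeff-+ (f 0 + S) (g 0) i ⟩
  coeff (f 0 + S) i ℤ.+ coeff (g 0) i
    ≡⟨ cong (ℤ._+ coeff (g 0) i) (coeff-+ (f 0) S i) ⟩
  coeff (f 0) i ℤ.+ coeff S i ℤ.+ coeff (g 0) i
    ≡⟨ rotate (coeff (f 0) i) (coeff S i) (coeff (g 0) i) ⟩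
  coeff S i ℤ.+ (coeff (f 0) i ℤ.+ coeff (g 0) i)
    ≡⟨ cong (ℤ._+_ (coeff S i)) (trans (sym (coeff-+ (f 0) (g 0) i)) (step 0 i)) ⟩
  coeff S i ℤ.+ coeff (g 1) i
    ≡⟨ coeff-+ S (g 1) i ⟨
  coeff (S + g 1) i
    ≡⟨ telescope (f ∘ suc) (g ∘ suc) (step ∘ suc) n i ⟩
  coeff (g (suc (suc n))) i ∎
  where
  S : Poly
  S = ∑≤ n (f ∘ suc)

  rotate : ∀ x y z → x ℤ.+ y ℤ.+ z ≡ y ℤ.+ (x ℤ.+ z)
  rotate = solve-∀

summand : ℕ → Poly
summand k = t ^ k * (const (Q k) + const (+ 2) * (t - 1#) * const (P (suc k)))

-- The sum of the summands with index strictly below `k`, so the theorem's right-hand side is its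
-- value at `suc n`.
partialSum : ℕ → Poly
partialSum k = const (+ 2) * t ^ k * const (P k)

summand-step : ∀ k → summand k + partialSum k ≈ partialSum (suc k)
summand-step k i = begin
  coeff (summand k + partialSum k) i
    ≡⟨ coeff-+ (summand k) (partialSum k) i ⟩
  coeff (summand k) i ℤ.+ coeff (partialSum k) i
    ≡⟨ cong₂ ℤ._+_ (coeff-*linear _ _ (t ^ k) i) (coeff-2*const (t ^ k) (P k) i) ⟩
  -- The bracket has become the linear polynomial with constant term Q_k - 2 P_{k+1} and leading
  -- coefficient 2 P_{k+1}; each `ℤ.+ 0ℤ` is left over from list multiplication.
  x ℤ.* (Q k ℤ.+ (ℤ.- + 2 ℤ.* P (suc k) ℤ.+ 0ℤ)) ℤ.+ y ℤ.* (+ 2 ℤ.* P (suc k) ℤ.+ 0ℤ)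
    ℤ.+ + 2 ℤ.* x ℤ.* P k
    ≡⟨ regroup x y (Q k) (P k) (P (suc k)) ⟩
  x ℤ.* (Q k ℤ.+ + 2 ℤ.* P k) ℤ.+ (+ 2 ℤ.* y ℤ.* P (suc k) ℤ.- x ℤ.* (+ 2 ℤ.* P (suc k)))
    ≡⟨ cong (λ z → x ℤ.* z ℤ.+ (+ 2 ℤ.* y ℤ.* P (suc k) ℤ.- x ℤ.* (+ 2 ℤ.* P (suc k)))) (Q+2P k) ⟩
  x ℤ.* (+ 2 ℤ.* P (suc k)) ℤ.+ (+ 2 ℤ.* y ℤ.* P (suc k) ℤ.- x ℤ.* (+ 2 ℤ.* P (suc k)))
    ≡⟨ cancel (x ℤ.* (+ 2 ℤ.* P (suc k))) (+ 2 ℤ.* y ℤ.* P (suc k)) ⟩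
  + 2 ℤ.* y ℤ.* P (suc k)
    ≡⟨ cong (λ z → + 2 ℤ.* z ℤ.* P (suc k)) (coeff-t* (t ^ k) i) ⟨
  + 2 ℤ.* coeff (t ^ suc k) i ℤ.* P (suc k)
    ≡⟨ coeff-2*const (t ^ suc k) (P (suc k)) i ⟨
  coeff (partialSum (suc k)) i ∎
  where
  x y : ℤ
  x = coeff (t ^ k) i
  y = coeff (0ℤ ∷ t ^ k) i

  regroup : ∀ x y q p₀ p₁ →
    x ℤ.* (q ℤ.+ (ℤ.- + 2 ℤ.* p₁ ℤ.+ 0ℤ)) ℤ.+ y ℤ.* (+ 2 ℤ.* p₁ ℤ.+ 0ℤ) ℤ.+ + 2 ℤ.* x ℤ.* p₀ ≡
    x ℤ.* (q ℤ.+ + 2 ℤ.* p₀) ℤ.+ (+ 2 ℤ.* y ℤ.* p₁ ℤ.- x ℤ.* (+ 2 ℤ.* p₁))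
  regroup = solve-∀

  cancel : ∀ u v → u ℤ.+ (v ℤ.- u) ≡ v
  cancel = solve-∀

mainTheorem4 : (n : ℕ) →
    ∑[ k ≤ n ] (t ^ k * (const (Q k) + const (+ 2) * (t - 1#) * const (P (suc k))))
    ≈ const (+ 2) * t ^ suc n * const (P (suc n))
mainTheorem4 n i = begin
  coeff (∑≤ n summand) i
    ≡⟨ +-identityʳ _ ⟨
  coeff (∑≤ n summand) i ℤ.+ 0ℤ
    -- Because `P 0` is zero, `partialSum 0` computes to `0ℤ ∷ []`, which is not the list `[]` but
    -- has only zero coefficients.
    ≡⟨ cong (ℤ._+_ (coeff (∑≤ n summand) i)) (coeff-0∷[] i) ⟨
  coeff (∑≤ n summand) i ℤ.+ coeff (partialSum 0) i
    ≡⟨ coeff-+ (∑≤ n summand) (partialSum 0) i ⟨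
  coeff (∑≤ n summand + partialSum 0) i
    ≡⟨ telescope summand partialSum summand-step n i ⟩
  coeff (partialSum (suc n)) i ∎
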